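{- The following conjecture of Voss is false: for each integer $k\ge 4$, $g_k(n)\to\infty$ as $n\to\infty$, where $g_k(n)$ denotes the largest integer $\alpha$ such that every $n$-vertex $k$-critical graph contains an odd cycle with at least $\alpha$ chords.
   Context: All graphs are finite and simple. A graph $G$ is $k$-critical if its chromatic number is $\chi(G)=k$ and every proper subgraph of $G$ is $(k-1)$-colorable. An odd cycle is a cycle of odd length. A chord of a cycle $C$ in $G$ is an edge of $G$ joining two vertices of $C$ that are not consecutive on $C$. -}

module Defs where

open import Data.Bool using (Bool; false; T)
open import Data.Bool.Properties using (T?)
open import Data.Fin using (Fin; toℕ) renaming (_<_ to _<ᶠ_; _<?_ to _<ᶠ?_)
open import Data.Fin.Subset using (Subset; _∈_; _∉_)
open import Data.List using (List; allFin; cartesianProduct; filter; length)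
open import Data.Nat using (ℕ; suc; _≤_; _∸_; _≟_; _%_)
open import Data.Product using (Σ-syntax; ∃; ∃-syntax; _×_; _,_; proj₁)
open import Data.Sum using (_⊎_)
open import Function.Definitions using (Injective)
open import Relation.Binary.Construct.Add.Supremum.NonStrict _≤_ using (_≤⁺_)
open import Relation.Binary.PropositionalEquality using (_≡_; _≢_)
open import Relation.Nullary using (¬_; Dec; ¬?; _×-dec_; _⊎-dec_)
open import Relation.Nullary.Construct.Add.Supremum using (_⁺; [_]; ⊤⁺)

record Graph (V : Set) : Set where
  field
    adj    : V → V → Bool
    sym    : ∀ u v → adj u v ≡ adj v u
    irrefl : ∀ v → adj v v ≡ false

  Adj : V → V → Set
  Adj u v = T (adj u v)

open Graph using (Adj)

Colorable : {V : Set} → Graph V → ℕ → Set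
Colorable {V} G m =
  Σ[ c ∈ (V → Fin m) ] (∀ u v → Adj G u v → c u ≢ c v)

HasChromaticNumber : {V : Set} → Graph V → ℕ → Set
HasChromaticNumber G k = Colorable G k × (∀ m → Colorable G m → k ≤ m)

-- Not necessarily induced or spanning.
record Subgraph {n : ℕ} (G : Graph (Fin n)) : Set where
  field
    verts   : Subset n
    graph   : Graph (∃ (_∈ verts))
    adj⊆    : ∀ u v → Adj graph u v → Adj G (proj₁ u) (proj₁ v)

-- A proper subgraph lacks a vertex of G, or an edge of G between two of
-- its own vertices.
Proper : ∀ {n} {G : Graph (Fin n)} → Subgraph G → Set
Proper {G = G} H =
  (∃[ v ] v ∉ verts) ⊎
  (∃[ u ] ∃[ v ] (Adj G (proj₁ u) (proj₁ v) × ¬ Adj graph u v))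
  where open Subgraph H

Critical : ∀ {n} → ℕ → Graph (Fin n) → Set
Critical k G =
  HasChromaticNumber G k ×
  ((H : Subgraph G) → Proper H → Colorable (Subgraph.graph H) (k ∸ 1))

-- j is the cyclic successor of i in 0, 1, …, ℓ - 1.
Next : ∀ {ℓ} → Fin ℓ → Fin ℓ → Set
Next {ℓ} i j = (toℕ j ≡ suc (toℕ i)) ⊎ (suc (toℕ i) ≡ ℓ × toℕ j ≡ 0)

next? : ∀ {ℓ} (i j : Fin ℓ) → Dec (Next i j)
next? {ℓ} i j =
  (toℕ j ≟ suc (toℕ i)) ⊎-dec ((suc (toℕ i) ≟ ℓ) ×-dec (toℕ j ≟ 0))

record Cycle {V : Set} (G : Graph V) : Set where
  field
    len       : ℕ
    3≤len     : 3 ≤ len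
    vertex    : Fin len → V
    injective : Injective _≡_ _≡_ vertex
    adjacent  : ∀ i j → Next i j → Adj G (vertex i) (vertex j)

OddCycle : {V : Set} → Graph V → Set
OddCycle G = Σ[ C ∈ Cycle G ] Cycle.len C % 2 ≡ 1

module _ {V : Set} {G : Graph V} (C : Cycle G) where
  open Cycle C

  -- A chord is recorded by the positions i < j of its ends on C; since
  -- the vertices of C are distinct, each chord is counted exactly once.
  IsChord : Fin len × Fin len → Set
  IsChord (i , j) =
    i <ᶠ j × Adj G (vertex i) (vertex j) × ¬ (Next i j ⊎ Next j i)

  isChord? : ∀ p → Dec (IsChord p)
  isChord? (i , j) =
    (i <ᶠ? j) ×-dec (T? _ ×-dec ¬? (next? i j ⊎-dec next? j i))

  chords : List (Fin len × Fin len)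
  chords = filter isChord? (cartesianProduct (allFin len) (allFin len))

  numChords : ℕ
  numChords = length chords

ForcesChords : ℕ → ℕ → ℕ → Set
ForcesChords k n α =
  (G : Graph (Fin n)) → Critical k G →
  Σ[ C ∈ OddCycle G ] α ≤ numChords (proj₁ C)

-- IsG k n x means g_k(n) = x.  The value ⊤⁺ (infinity) is the usual
-- convention for the n that admit no n-vertex k-critical graph, such as
-- n = k + 1: every α then qualifies and there is no largest one.
IsG : ℕ → ℕ → ℕ ⁺ → Set
IsG k n [ α ] = ForcesChords k n α × (∀ β → ForcesChords k n β → β ≤ α)
IsG k n ⊤⁺    = ∀ β → ForcesChords k n β

-- For a function ℕ → ℕ ∪ {∞} given by its graph F.
TendsToInfinity : (ℕ → ℕ ⁺ → Set) → Set
TendsToInfinity F =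
  ∀ M → ∃[ N ] (∀ n → N ≤ n → ∃[ x ] (F n x × [ M ] ≤⁺ x))

VossConjecture : Set
VossConjecture = ∀ k → 4 ≤ k → TendsToInfinity (IsG k)

{-# OPTIONS --safe #-}
-- Replace every spoke of an odd wheel by a diamond with a pendant edge (an
-- iterated Hajós join with K₄).  The result is again 4-critical and
-- arbitrarily large.  A cycle enters a gadget only through the hub, unless it
-- is the triangle inside that gadget, so all chords of a cycle lie in or next
-- to the at most two gadgets that contain its neighbours of the hub.
module Submission where

open import Defs
open import Data.Bool using (Bool; true; false; T; not; _∨_; if_then_else_)
open import Data.Bool.Properties using (∨-comm; T-∨; not-involutive)
open import Data.Empty using (⊥-elim)
open import Data.Fin using (Fin; zero; suc; toℕ; fromℕ<; inject≤; combine; remQuot; _≟_)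
open import Data.Fin.Patterns using (0F; 1F; 2F; 3F)
open import Data.Fin.Properties
  using (toℕ-injective; toℕ<n; toℕ-fromℕ<; inject≤-injective; injective⇒≤;
         combine-remQuot; remQuot-combine; all?; <⇒≢)
open import Data.List using (List; []; _∷_; _++_; length; map; lookup; cartesianProduct; allFin)
open import Data.List.Membership.Propositional using (_∈_)
open import Data.List.Membership.Propositional.Properties
  using (∈-lookup; ∈-map⁻; ∈-cartesianProduct⁺; ∈-++⁺ˡ; ∈-++⁺ʳ)
open import Data.List.Membership.Setoid.Properties using (index-injective)
open import Data.List.Properties using (length-map)
open import Data.List.Relation.Binary.Subset.Propositional using (_⊆_)
open import Data.List.Relation.Unary.All as All using (All; []; _∷_)
open import Data.List.Relation.Unary.All.Properties using (all-filter)
open import Data.List.Relation.Unary.AllPairs using ([]; _∷_)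
open import Data.List.Relation.Unary.Any using (here; there; index)
open import Data.List.Relation.Unary.Unique.Propositional using (Unique)
import Data.List.Relation.Unary.Unique.Propositional.Properties as Uniq
open import Data.Nat using (ℕ; zero; suc; _+_; _*_; _∸_; _≤_; _<_; z≤n; s≤s; _≤?_; _<?_)
open import Data.Nat.Properties
  using (≤-refl; ≤-trans; ≤-reflexive; ≤-antisym; <-irrefl; ≰⇒>; ≮⇒≥; n≤1+n; m≤m*n; m≤n+m;
         +-suc; +-identityʳ; suc-injective; 1+n≰n; ≤-pred; m∸n+n≡m; +-comm)
open import Data.Product using (Σ-syntax; ∃; ∃₂; _×_; _,_; proj₁; proj₂; uncurry; swap)
open import Data.Product.Properties using (,-injective)
open import Data.Sum using (_⊎_; inj₁; inj₂; [_,_]′) renaming (swap to ⊎-swap)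
open import Data.Vec.Properties.WithK using ([]=-irrelevant)
open import Function using (_∘_; case_of_)
open import Function.Bundles using (Equivalence)
open import Function.Definitions using (Injective)
open import Relation.Binary.Construct.Add.Supremum.NonStrict _≤_ using ([_])
open import Relation.Binary.PropositionalEquality
  using (_≡_; _≢_; refl; sym; trans; cong; cong₂; subst; subst₂; setoid)
open import Relation.Nullary using (¬_; yes; no; contradiction; ¬?; _→-dec_)
open import Relation.Nullary.Construct.Add.Supremum using () renaming ([_] to [_]⁺; ⊤⁺ to ∞)
open import Relation.Nullary.Decidable using (⌊_⌋; toWitness; fromWitness)

open Graph using (Adj)

-- Counting by duplicate-free lists.

lookup-injective : ∀ {A : Set} {xs : List A} → Unique xs →
                   Injective _≡_ _≡_ (lookup xs)
lookup-injective (_ ∷ _)  {zero}  {zero}  _  = refl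
lookup-injective (x∉ ∷ _) {zero}  {suc j} eq = contradiction eq (All.lookup x∉ (∈-lookup j))
lookup-injective (x∉ ∷ _) {suc i} {zero}  eq = contradiction (sym eq) (All.lookup x∉ (∈-lookup i))
lookup-injective (_ ∷ u)  {suc i} {suc j} eq = cong suc (lookup-injective u eq)

-- Each position of `xs` is sent to the index in `ys` of its entry. Equal indices mean equal
-- entries, and a duplicate-free list has no entry at two positions.
unique-⊆⇒length≤ : ∀ {A : Set} {xs ys : List A} → Unique xs → xs ⊆ ys →
                   length xs ≤ length ys
unique-⊆⇒length≤ {A} u xs⊆ys =
  injective⇒≤ {f = λ i → index (xs⊆ys (∈-lookup i))}
    (λ eq → lookup-injective u (index-injective (setoid A)
      (xs⊆ys (∈-lookup _)) (xs⊆ys (∈-lookup _)) eq))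

-- Cyclic successors

module _ {ℓ : ℕ} where

  Near : Fin ℓ → Fin ℓ → Set
  Near i j = Next i j ⊎ Next j i

  next-functional : ∀ {i j k : Fin ℓ} → Next i j → Next i k → j ≡ k
  next-functional (inj₁ p) (inj₁ q) = toℕ-injective (trans p (sym q))
  next-functional {j = j} (inj₁ p) (inj₂ (q , _)) =
    contradiction (toℕ<n j) (<-irrefl (trans p q))
  next-functional {k = k} (inj₂ (p , _)) (inj₁ q) =
    contradiction (toℕ<n k) (<-irrefl (trans q p))
  next-functional (inj₂ (_ , p)) (inj₂ (_ , q)) = toℕ-injective (trans p (sym q))

  next-injective : ∀ {i j k : Fin ℓ} → Next i k → Next j k → i ≡ j
  next-injective (inj₁ p) (inj₁ q) = toℕ-injective (suc-injective (trans (sym p) q))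
  next-injective (inj₁ p) (inj₂ (_ , q)) = case trans (sym p) q of λ ()
  next-injective (inj₂ (_ , p)) (inj₁ q) = case trans (sym q) p of λ ()
  next-injective (inj₂ (p , _)) (inj₂ (q , _)) =
    toℕ-injective (suc-injective (trans p (sym q)))

next-exists : ∀ {ℓ} (i : Fin ℓ) → ∃ (Next i)
next-exists {suc ℓ} i with suc (toℕ i) <? suc ℓ
... | yes i+1<ℓ = fromℕ< i+1<ℓ , inj₁ (toℕ-fromℕ< i+1<ℓ)
... | no  i+1≮ℓ = zero , inj₂ (≤-antisym (toℕ<n i) (≮⇒≥ i+1≮ℓ) , refl)

prev-exists : ∀ {ℓ} (i : Fin ℓ) → ∃ λ j → Next j i
prev-exists {suc ℓ} zero = fromℕ< {ℓ} ≤-refl , inj₂ (cong suc (toℕ-fromℕ< _) , refl)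
prev-exists {suc ℓ} (suc i) =
  fromℕ< i<ℓ , inj₁ (cong suc (sym (toℕ-fromℕ< i<ℓ)))
  where i<ℓ = ≤-trans (toℕ<n i) (n≤1+n ℓ)

-- At lengths 1 and 2 every position succeeds its own successor, hence the bound. The case `i = j`
-- also makes the rim loopless.
next-asym : ∀ {ℓ} → 3 ≤ ℓ → {i j : Fin ℓ} → Next i j → ¬ Next j i
next-asym _ {i} {j} (inj₁ p) (inj₁ q) =
  contradiction (subst (toℕ i <_) (sym q) (≤-trans (n≤1+n _) (s≤s (≤-reflexive (sym p)))))
                (<-irrefl refl)
next-asym (s≤s (s≤s (s≤s _))) (inj₁ p) (inj₂ (q , r)) =
  case trans (sym q) (cong suc (trans p (cong suc r))) of λ ()
next-asym (s≤s (s≤s (s≤s _))) (inj₂ (q , r)) (inj₁ p) =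
  case trans (sym q) (cong suc (trans p (cong suc r))) of λ ()
next-asym (s≤s (s≤s (s≤s _))) (inj₂ (p , _)) (inj₂ (_ , q)) =
  case trans (sym p) (cong suc q) of λ ()

-- The walk may start anywhere: it runs from `i` to the last position, wraps around to `zero` and
-- climbs from there to `j`.
next-induction : ∀ {ℓ} (P : Fin ℓ → Set) → (∀ {i j} → Next i j → P i → P j) →
                 ∀ {i} → P i → ∀ j → P j
next-induction {suc ℓ} P step {i} pi j =
  subst P (toℕ-injective (toℕ-fromℕ< (toℕ<n j))) (ascend (toℕ j) (toℕ<n j))
  where
  -- `d` is the number of positions after `i`; the wrap is due when it reaches 0.
  return : ∀ d {i} → suc (toℕ i) + d ≡ suc ℓ → P i → P zero
  return zero    eq pi = step (inj₂ (trans (sym (+-identityʳ _)) eq , refl)) pi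
  return (suc d) {i} eq pi with next-exists i
  ... | i′ , inj₁ e =
    return d (trans (cong (λ x → suc x + d) e) (trans (sym (+-suc _ d)) eq)) (step (inj₁ e) pi)
  ... | zero , inj₂ e = step (inj₂ e) pi

  p₀ : P zero
  p₀ = return (suc ℓ ∸ suc (toℕ i)) (trans (+-comm (suc (toℕ i)) _) (m∸n+n≡m (toℕ<n i))) pi

  ascend : ∀ a (a<ℓ : a < suc ℓ) → P (fromℕ< a<ℓ)
  ascend zero    _   = p₀
  ascend (suc a) a<ℓ =
    step (inj₁ (trans (toℕ-fromℕ< a<ℓ) (cong suc (sym (toℕ-fromℕ< a<ℓ′))))) (ascend a a<ℓ′)
    where a<ℓ′ = ≤-trans (n≤1+n (suc a)) a<ℓ

-- The graph

-- `hub`, `apex i` and the two `side` vertices of `i` form the diamond, a K₄ without the edge from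
-- `hub` to `apex i`. The pendant edge joins `apex i` to `rim i`.
data Vertex (m : ℕ) : Set where
  hub      : Vertex m
  rim apex : Fin m → Vertex m
  side     : Bool → Fin m → Vertex m

private variable
  m : ℕ

infix 4 _⟶_ _—_

-- Every edge gets one fixed direction, so that a case analysis meets each kind of edge once. `_—_`
-- restores symmetry, and `arc` is the Boolean form that `Graph` asks for.
data _⟶_ {m : ℕ} : Vertex m → Vertex m → Set where
  rim-rim   : ∀ {i j} → Next i j → rim i ⟶ rim j
  rim-apex  : ∀ {i} → rim i ⟶ apex i
  apex-side : ∀ {i} s → apex i ⟶ side s i
  side-side : ∀ {i} → side false i ⟶ side true i
  hub-side  : ∀ {i} s → hub ⟶ side s i

_—_ : Vertex m → Vertex m → Set
u — v = u ⟶ v ⊎ v ⟶ u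

arc : Vertex m → Vertex m → Bool
arc (rim i)        (rim j)       = ⌊ next? i j ⌋
arc (rim i)        (apex j)      = ⌊ i ≟ j ⌋
arc (apex i)       (side _ j)    = ⌊ i ≟ j ⌋
arc (side false i) (side true j) = ⌊ i ≟ j ⌋
arc hub            (side _ _)    = true
arc _              _             = false

arc-sound : ∀ (u v : Vertex m) → T (arc u v) → u ⟶ v
arc-sound (rim i) (rim j) p = rim-rim (toWitness p)
arc-sound (rim i) (apex j) p with refl ← toWitness {a? = i ≟ j} p = rim-apex
arc-sound (apex i) (side s j) p with refl ← toWitness {a? = i ≟ j} p = apex-side s
arc-sound (side false i) (side true j) p with refl ← toWitness {a? = i ≟ j} p = side-side
arc-sound hub (side s i) _ = hub-side s

arc-complete : ∀ {u v : Vertex m} → u ⟶ v → T (arc u v)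
arc-complete (rim-rim p)         = fromWitness p
arc-complete {u = rim i} rim-apex  = fromWitness {a? = i ≟ i} refl
arc-complete {u = apex i} (apex-side _) = fromWitness {a? = i ≟ i} refl
arc-complete {u = side _ i} side-side = fromWitness {a? = i ≟ i} refl
arc-complete (hub-side _)        = _

⟶-irrefl : 3 ≤ m → {v : Vertex m} → ¬ v ⟶ v
⟶-irrefl 3≤m (rim-rim p) = next-asym 3≤m p p

¬T⇒false : ∀ {b} → ¬ T b → b ≡ false
¬T⇒false {true}  ¬t = ⊥-elim (¬t _)
¬T⇒false {false} _  = refl

splitWheel : 3 ≤ m → Graph (Vertex m)
splitWheel 3≤m = record
  { adj    = λ u v → arc u v ∨ arc v u
  ; sym    = λ u v → ∨-comm (arc u v) (arc v u)
  ; irrefl = λ v → cong (λ b → b ∨ b) (¬T⇒false (⟶-irrefl 3≤m ∘ arc-sound v v))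
  }

module _ (3≤m : 3 ≤ m) where

  adj⇒— : ∀ {u v} → Adj (splitWheel 3≤m) u v → u — v
  adj⇒— {u} {v} e =
    [ inj₁ ∘ arc-sound u v , inj₂ ∘ arc-sound v u ]′ (Equivalence.to T-∨ e)

  —⇒adj : ∀ {u v} → u — v → Adj (splitWheel 3≤m) u v
  —⇒adj = Equivalence.from T-∨ ∘ [ inj₁ ∘ arc-complete , inj₂ ∘ arc-complete ]′

-- Chords of cycles

module CycleChords (3≤m : 3 ≤ m) (C : Cycle (splitWheel 3≤m)) where

  open Cycle C renaming (vertex to w)

  near-adjacent : ∀ {p q : Fin len} → Near p q → w p — w q
  near-adjacent (inj₁ e) = adj⇒— 3≤m (adjacent _ _ e)
  near-adjacent (inj₂ e) = ⊎-swap (adj⇒— 3≤m (adjacent _ _ e))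

  same-position : ∀ {p q v} → w p ≡ v → w q ≡ v → p ≡ q
  same-position e f = injective (trans e (sym f))

  near-pair : ∀ p → ∃₂ λ q r → q ≢ r × Near p q × Near p r
  near-pair p with next-exists p | prev-exists p
  ... | q , pq | r , rp = q , r , (λ { refl → next-asym 3≤len pq rp }) , inj₁ pq , inj₂ rp

  near-other : ∀ {p q : Fin len} → Near p q → ∃ λ r → r ≢ q × Near p r
  near-other {p} (inj₁ pq) with prev-exists p
  ... | r , rp = r , (λ { refl → next-asym 3≤len pq rp }) , inj₂ rp
  near-other {p} (inj₂ qp) with next-exists p
  ... | r , pr = r , (λ { refl → next-asym 3≤len pr qp }) , inj₁ pr

  -- Two distinct neighbours cannot both be successors or both be predecessors of `p`, so they are
  -- one of each and exhaust the possibilities.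
  near-only : ∀ {p q r t : Fin len} → q ≢ r → Near p q → Near p r → Near p t → t ≡ q ⊎ t ≡ r
  near-only _   (inj₁ a) _        (inj₁ c) = inj₁ (next-functional c a)
  near-only _   _        (inj₁ b) (inj₁ c) = inj₂ (next-functional c b)
  near-only q≢r (inj₂ a) (inj₂ b) (inj₁ c) = contradiction (next-injective a b) q≢r
  near-only _   (inj₂ a) _        (inj₂ c) = inj₁ (next-injective c a)
  near-only _   _        (inj₂ b) (inj₂ c) = inj₂ (next-injective c b)
  near-only q≢r (inj₁ a) (inj₁ b) (inj₂ c) = contradiction (next-functional a b) q≢r

  -- Three mutually near positions are closed under successors, so by `next-induction` they are the
  -- whole cycle, and a triangle has no chord.
  triangle-near : ∀ {p q r : Fin len} → p ≢ q → p ≢ r → q ≢ r → Near p q → Near p r → Near q r →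
                  ∀ {x y : Fin len} → x ≢ y → Near x y
  triangle-near {p} {q} {r} p≢q p≢r q≢r pq pr qr = connected (covers _) (covers _)
    where
    OnTriangle : Fin len → Set
    OnTriangle t = t ≡ p ⊎ t ≡ q ⊎ t ≡ r

    closed : ∀ {s t : Fin len} → Next s t → OnTriangle s → OnTriangle t
    closed st (inj₁ refl) = inj₂ (near-only q≢r pq pr (inj₁ st))
    closed st (inj₂ (inj₁ refl)) with near-only p≢r (⊎-swap pq) qr (inj₁ st)
    ... | inj₁ e = inj₁ e
    ... | inj₂ e = inj₂ (inj₂ e)
    closed st (inj₂ (inj₂ refl)) with near-only p≢q (⊎-swap pr) (⊎-swap qr) (inj₁ st)
    ... | inj₁ e = inj₁ e
    ... | inj₂ e = inj₂ (inj₁ e)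

    covers : ∀ t → OnTriangle t
    covers = next-induction OnTriangle closed (inj₁ refl)

    connected : ∀ {x y} → OnTriangle x → OnTriangle y → x ≢ y → Near x y
    connected (inj₁ refl)        (inj₁ refl)        x≢y = contradiction refl x≢y
    connected (inj₁ refl)        (inj₂ (inj₁ refl)) _   = pq
    connected (inj₁ refl)        (inj₂ (inj₂ refl)) _   = pr
    connected (inj₂ (inj₁ refl)) (inj₁ refl)        _   = ⊎-swap pq
    connected (inj₂ (inj₁ refl)) (inj₂ (inj₁ refl)) x≢y = contradiction refl x≢y
    connected (inj₂ (inj₁ refl)) (inj₂ (inj₂ refl)) _   = qr
    connected (inj₂ (inj₂ refl)) (inj₁ refl)        _   = ⊎-swap pr
    connected (inj₂ (inj₂ refl)) (inj₂ (inj₁ refl)) _   = ⊎-swap qr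
    connected (inj₂ (inj₂ refl)) (inj₂ (inj₂ refl)) x≢y = contradiction refl x≢y

  -- Neighbourhoods, and gadgets entered from the hub.

  hub-neighbour : ∀ {v : Vertex m} → hub — v → ∃₂ λ s i → v ≡ side s i
  hub-neighbour (inj₁ (hub-side s)) = s , _ , refl

  side-neighbour : ∀ {s i} {v : Vertex m} → side s i — v →
                   v ≡ hub ⊎ v ≡ apex i ⊎ v ≡ side (not s) i
  side-neighbour (inj₁ side-side)     = inj₂ (inj₂ refl)
  side-neighbour (inj₂ (apex-side _)) = inj₂ (inj₁ refl)
  side-neighbour (inj₂ side-side)     = inj₂ (inj₂ refl)
  side-neighbour (inj₂ (hub-side _))  = inj₁ refl

  apex-neighbour : ∀ {i} {v : Vertex m} → apex i — v → v ≡ rim i ⊎ ∃ λ s → v ≡ side s i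
  apex-neighbour (inj₁ (apex-side s)) = inj₂ (s , refl)
  apex-neighbour (inj₂ rim-apex)      = inj₁ refl

  rim-neighbour : ∀ {i} {v : Vertex m} → rim i — v →
                  v ≡ apex i ⊎ (∃ λ j → Next i j × v ≡ rim j) ⊎ (∃ λ j → Next j i × v ≡ rim j)
  rim-neighbour (inj₁ (rim-rim e)) = inj₂ (inj₁ (_ , e , refl))
  rim-neighbour (inj₁ rim-apex)    = inj₁ refl
  rim-neighbour (inj₂ (rim-rim e)) = inj₂ (inj₂ (_ , e , refl))

  neighbour : ∀ {p q v} → w p ≡ v → Near p q → v — w q
  neighbour refl = near-adjacent

  -- The cycle runs along an edge between `hub` and gadget `i`. Chords are charged to such gadgets
  -- because a cycle enters at most two of them.
  Entered : Fin m → Set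
  Entered i = ∃₂ λ p q → Near p q × w p ≡ hub × ∃ λ s → w q ≡ side s i

  -- Such a pair shows that the cycle is not a triangle. This excludes the one cycle that visits a
  -- side without entering from the hub: the triangle on `apex i` and its two sides.
  module _ {x y : Fin len} (x≢y : x ≢ y) (¬xy : ¬ Near x y) where

    -- Follow the cycle from `p` past the other side at `r`. The next vertex is not the one at `p`;
    -- if it is the apex, the cycle closes up to a triangle; so it is the hub.
    both-sides-entered : ∀ {p q r : Fin len} {s i} → w p ≡ side s i → Near p q → Near p r →
                         w q ≡ apex i → w r ≡ side (not s) i → Entered i
    both-sides-entered {p} {q} {r} {s} {i} ep pq pr eq er
      with near-other (⊎-swap pr)
    ... | t , t≢p , rt with side-neighbour (neighbour er rt)
    ... | inj₁ et = t , r , ⊎-swap rt , et , _ , er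
    ... | inj₂ (inj₂ et) =
      contradiction (same-position (trans et (cong (λ b → side b i) (not-involutive s))) ep) t≢p
    ... | inj₂ (inj₁ et) with refl ← same-position et eq =
      contradiction
        (triangle-near
          (λ { refl → case trans (sym ep) eq of λ () })
          (t≢p ∘ λ { refl → contradiction (trans (sym ep) er) side≢ })
          (λ { refl → case trans (sym eq) er of λ () })
          pq pr (⊎-swap rt) x≢y)
        ¬xy
      where
      side≢ : ∀ {s} → side {m} s i ≢ side (not s) i
      side≢ {true}  ()
      side≢ {false} ()

    -- Besides the hub a side has only two neighbours, the apex and the other side. A cycle that
    -- avoids the hub here uses both, which is the case of `both-sides-entered`.
    side-entered : ∀ {p s i} → w p ≡ side s i → Entered i
    side-entered {p} ep with near-pair p
    ... | q , r , q≢r , pq , pr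
      with side-neighbour (neighbour ep pq) | side-neighbour (neighbour ep pr)
    ... | inj₁ eq        | _              = q , p , ⊎-swap pq , eq , _ , ep
    ... | inj₂ _         | inj₁ er        = r , p , ⊎-swap pr , er , _ , ep
    ... | inj₂ (inj₁ eq) | inj₂ (inj₁ er) = contradiction (same-position eq er) q≢r
    ... | inj₂ (inj₁ eq) | inj₂ (inj₂ er) = both-sides-entered ep pq pr eq er
    ... | inj₂ (inj₂ eq) | inj₂ (inj₁ er) = both-sides-entered ep pr pq er eq
    ... | inj₂ (inj₂ eq) | inj₂ (inj₂ er) = contradiction (same-position eq er) q≢r

    -- Only one of the two cycle neighbours can be `rim i`; the other is a side.
    apex-entered : ∀ {p i} → w p ≡ apex i → Entered i
    apex-entered {p} ep with near-pair p
    ... | q , r , q≢r , pq , pr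
      with apex-neighbour (neighbour ep pq) | apex-neighbour (neighbour ep pr)
    ... | inj₂ (_ , eq) | _             = side-entered eq
    ... | inj₁ _        | inj₂ (_ , er) = side-entered er
    ... | inj₁ eq       | inj₁ er       = contradiction (same-position eq er) q≢r

    -- The cycle does not go from `x` to `rim j`, since `y` is not near `x`. At most one cycle
    -- neighbour of `x` is the preceding rim vertex, so the other one is `apex i`.
    rim-entered : ∀ {i j} → w x ≡ rim i → w y ≡ rim j → Next i j → Entered i
    rim-entered ex ey ij with near-pair x
    ... | q , r , q≢r , xq , xr
      with rim-neighbour (neighbour ex xq) | rim-neighbour (neighbour ex xr)
    ... | inj₁ eq | _ = apex-entered eq
    ... | _ | inj₁ er = apex-entered er
    ... | inj₂ (inj₁ (_ , ik , eq)) | _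
      with refl ← next-functional ij ik with refl ← same-position ey eq = contradiction xq ¬xy
    ... | _ | inj₂ (inj₁ (_ , ik , er))
      with refl ← next-functional ij ik with refl ← same-position ey er = contradiction xr ¬xy
    ... | inj₂ (inj₂ (_ , ki , eq)) | inj₂ (inj₂ (_ , li , er))
      with refl ← next-injective ki li = contradiction (same-position eq er) q≢r

  -- These vertices contain both ends of every edge charged to gadget `i`. A rim edge is charged to
  -- the index of its tail, hence the successor on the rim.
  vicinity : Fin m → List (Vertex m)
  vicinity i =
    hub ∷ rim i ∷ rim (proj₁ (next-exists i)) ∷ apex i ∷ side false i ∷ side true i ∷ []

  side∈vicinity : ∀ s {i} → side s i ∈ vicinity i
  side∈vicinity false = there (there (there (there (here refl))))
  side∈vicinity true  = there (there (there (there (there (here refl)))))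

  arc-entered : ∀ {x y : Fin len} {u v} → x ≢ y → ¬ Near x y → w x ≡ u → w y ≡ v → u ⟶ v →
                ∃ λ i → Entered i × u ∈ vicinity i × v ∈ vicinity i
  arc-entered x≢y ¬xy ex ey (rim-rim {i} e) =
    i , rim-entered x≢y ¬xy ex ey e , there (here refl) ,
    there (there (here (cong rim (next-functional e (proj₂ (next-exists i))))))
  arc-entered x≢y ¬xy ex ey rim-apex =
    _ , apex-entered x≢y ¬xy ey , there (here refl) , there (there (there (here refl)))
  arc-entered x≢y ¬xy ex ey (apex-side s) =
    _ , apex-entered x≢y ¬xy ex , there (there (there (here refl))) , side∈vicinity s
  arc-entered x≢y ¬xy ex ey side-side =
    _ , side-entered x≢y ¬xy ex , side∈vicinity false , side∈vicinity true
  arc-entered x≢y ¬xy ex ey (hub-side s) =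
    _ , side-entered x≢y ¬xy ey , here refl , side∈vicinity s

  chord-entered : ∀ {x y} → IsChord C (x , y) →
                  ∃ λ i → Entered i × w x ∈ vicinity i × w y ∈ vicinity i
  chord-entered (x<y , adj , ¬xy) with adj⇒— 3≤m adj
  ... | inj₁ xy = arc-entered (<⇒≢ x<y) ¬xy refl refl xy
  ... | inj₂ yx with arc-entered (<⇒≢ x<y ∘ sym) (¬xy ∘ ⊎-swap) refl refl yx
  ... | i , ent , y∈ , x∈ = i , ent , x∈ , y∈

  -- The given entry only shows that the cycle meets `hub`. It does so at one position, and `i` and
  -- `j`, possibly equal, are the gadgets of the two neighbours there; every entry uses one of
  -- these.
  entered-cover : ∀ {l} → Entered l → ∃₂ λ i j → ∀ {k} → Entered k → k ≡ i ⊎ k ≡ j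
  entered-cover (p , _ , _ , ep , _) with near-pair p
  ... | q , r , q≢r , pq , pr
    with hub-neighbour (neighbour ep pq) | hub-neighbour (neighbour ep pr)
  ... | _ , i , eq | _ , j , er = i , j , covered
    where
    covered : ∀ {k} → Entered k → k ≡ i ⊎ k ≡ j
    covered (p′ , t , pt , ep′ , _ , et) with refl ← same-position ep ep′
      with near-only q≢r pq pr pt
    ... | inj₁ refl = case trans (sym et) eq of λ { refl → inj₁ refl }
    ... | inj₂ refl = case trans (sym et) er of λ { refl → inj₂ refl }

  -- 144 = 12²: both ends of a chord lie in a list of 6 + 6 vertices.
  few-chords : ∀ ps → Unique ps → All (IsChord C) ps → length ps ≤ 144
  few-chords [] _ _ = z≤n
  few-chords ps@(_ ∷ _) uniq chs@(ch ∷ _)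
    -- The first chord of the list supplies the entry that `entered-cover` starts from.
    with entered-cover (proj₁ (proj₂ (chord-entered ch)))
  ... | i , j , covered =
    subst (_≤ 144) (length-map ends ps)
      (unique-⊆⇒length≤ {ys = cartesianProduct ends-list ends-list}
        (Uniq.map⁺ ends-injective uniq) ends⊆)
    where
    ends-list : List (Vertex m)
    ends-list = vicinity i ++ vicinity j

    ends : Fin len × Fin len → Vertex m × Vertex m
    ends (x , y) = w x , w y

    ends-injective : ∀ {e f} → ends e ≡ ends f → e ≡ f
    ends-injective eq with ,-injective eq
    ... | a , b = cong₂ _,_ (injective a) (injective b)

    in-list : ∀ {k v} → k ≡ i ⊎ k ≡ j → v ∈ vicinity k → v ∈ ends-list
    in-list (inj₁ refl) = ∈-++⁺ˡ
    in-list (inj₂ refl) = ∈-++⁺ʳ (vicinity i)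

    ends⊆ : map ends ps ⊆ cartesianProduct ends-list ends-list
    ends⊆ e∈ with ∈-map⁻ ends e∈
    ... | (x , y) , p∈ , refl with chord-entered (All.lookup chs p∈)
    ... | k , ent , x∈ , y∈ =
      ∈-cartesianProduct⁺ {xs = ends-list} {ys = ends-list}
        (in-list (covered ent) x∈) (in-list (covered ent) y∈)

  numChords≤144 : numChords C ≤ 144
  numChords≤144 =
    few-chords (chords C)
      (Uniq.filter⁺ (isChord? C) (Uniq.cartesianProduct⁺ (Uniq.allFin⁺ len) (Uniq.allFin⁺ len)))
      (all-filter (isChord? C) (cartesianProduct (allFin len) (allFin len)))

-- Criticality

pullback : ∀ {A B : Set} → (A → B) → Graph B → Graph A
pullback f G = record
  { adj    = λ u v → Graph.adj G (f u) (f v)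
  ; sym    = λ u v → Graph.sym G (f u) (f v)
  ; irrefl = λ v → Graph.irrefl G (f v)
  }

push : ∀ {A B : Set} {f : A → B} {G : Graph B} → Injective _≡_ _≡_ f →
       Cycle (pullback f G) → Cycle G
push {f = f} f-injective C = record
  { len       = len
  ; 3≤len     = 3≤len
  ; vertex    = f ∘ vertex
  ; injective = injective ∘ f-injective
  ; adjacent  = adjacent
  }
  where open Cycle C

NoIsolated : {V : Set} → Graph V → Set
NoIsolated G = ∀ v → ∃ (Adj G v)

-- Deletion of the edge `uv` is encoded without a new graph: `f` colours all of `V` and only that
-- edge, in either orientation, is exempt.
EdgeCritical : {V : Set} → Graph V → ℕ → Set
EdgeCritical {V} G c = ∀ u v → Adj G u v →
  Σ[ f ∈ (V → Fin c) ] (∀ s t → Adj G s t → (s ≡ u × t ≡ v) ⊎ (s ≡ v × t ≡ u) ⊎ f s ≢ f t)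

-- A proper subgraph misses some edge of `G`: the given one, or one at the missing vertex, which is
-- not isolated. The colouring of `G` without that edge restricts to the subgraph.
edgeCritical⇒properColorable :
  ∀ {n c} {G : Graph (Fin n)} → NoIsolated G → EdgeCritical G c →
  (H : Subgraph G) → Proper H → Colorable (Subgraph.graph H) c
edgeCritical⇒properColorable noIso crit H (inj₁ (v , v∉)) with noIso v
... | u , vu with crit v u vu
... | f , off = f ∘ proj₁ , proper
  where
  open Subgraph H
  proper : ∀ s t → Adj graph s t → f (proj₁ s) ≢ f (proj₁ t)
  proper s@(_ , s∈) t@(_ , t∈) st with off _ _ (adj⊆ s t st)
  ... | inj₁ (refl , _)        = contradiction s∈ v∉
  ... | inj₂ (inj₁ (_ , refl)) = contradiction t∈ v∉
  ... | inj₂ (inj₂ ne)         = ne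
edgeCritical⇒properColorable noIso crit H (inj₂ ((u , u∈) , (v , v∈) , uv , ¬uv)) with crit u v uv
... | f , off = f ∘ proj₁ , proper
  where
  open Subgraph H
  proper : ∀ s t → Adj graph s t → f (proj₁ s) ≢ f (proj₁ t)
  proper s@(_ , s∈) t@(_ , t∈) st with off _ _ (adj⊆ s t st)
  -- Vertices of a subgraph carry membership proofs. These are unique, so equality of the underlying
  -- vertices turns `st` into the missing edge.
  ... | inj₁ (refl , refl)
    with refl ← []=-irrelevant s∈ u∈ | refl ← []=-irrelevant t∈ v∈ = contradiction st ¬uv
  ... | inj₂ (inj₁ (refl , refl))
    with refl ← []=-irrelevant s∈ v∈ | refl ← []=-irrelevant t∈ u∈ =
      contradiction (subst T (Graph.sym graph s t) st) ¬uv
  ... | inj₂ (inj₂ ne) = ne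

colorable-mono : ∀ {V : Set} {G : Graph V} {a b} → a ≤ b → Colorable G a → Colorable G b
colorable-mono a≤b (c , proper) =
  (λ v → inject≤ (c v) a≤b) , λ u v e → proper u v e ∘ inject≤-injective _ _ _ _

chromaticNumber : ∀ {V : Set} {G : Graph V} {c} → Colorable G (suc c) → ¬ Colorable G c →
                  HasChromaticNumber G (suc c)
chromaticNumber {G = G} col ¬col =
  col , λ a col-a → ≰⇒> λ a≤c → ¬col (colorable-mono {G = G} a≤c col-a)

-- Numbering the vertices, in blocks of four after the hub.

module _ {m : ℕ} where

  node : Fin m × Fin 4 → Vertex m
  node (i , 0F) = rim i
  node (i , 1F) = apex i
  node (i , 2F) = side false i
  node (i , 3F) = side true i

  decode : Fin (suc (m * 4)) → Vertex m
  decode zero    = hub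
  decode (suc x) = node (remQuot 4 x)

  encode : Vertex m → Fin (suc (m * 4))
  encode hub            = zero
  encode (rim i)        = suc (combine i 0F)
  encode (apex i)       = suc (combine i 1F)
  encode (side false i) = suc (combine i 2F)
  encode (side true i)  = suc (combine i 3F)

  decode-encode : ∀ v → decode (encode v) ≡ v
  decode-encode hub            = refl
  decode-encode (rim i)        = cong node (remQuot-combine i 0F)
  decode-encode (apex i)       = cong node (remQuot-combine i 1F)
  decode-encode (side false i) = cong node (remQuot-combine i 2F)
  decode-encode (side true i)  = cong node (remQuot-combine i 3F)

  encode-node : ∀ p → encode (node p) ≡ suc (uncurry combine p)
  encode-node (i , 0F) = refl
  encode-node (i , 1F) = refl
  encode-node (i , 2F) = refl
  encode-node (i , 3F) = refl

  encode-decode : ∀ x → encode (decode x) ≡ x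
  encode-decode zero    = refl
  encode-decode (suc x) = trans (encode-node (remQuot 4 x)) (cong suc (combine-remQuot {m} 4 x))

  decode-injective : Injective _≡_ _≡_ decode
  decode-injective {x} {y} e =
    trans (sym (encode-decode x)) (trans (cong encode e) (encode-decode y))

-- Colourings

-- Two distinct colours leave just one of three; the decision procedure checks all quadruples.
third-colour-unique : ∀ (p q x y : Fin 3) → p ≢ q → x ≢ p → x ≢ q → y ≢ p → y ≢ q → x ≡ y
third-colour-unique = toWitness {a? =
  all? λ p → all? λ q → all? λ x → all? λ y →
    ¬? (p ≟ q) →-dec ¬? (x ≟ p) →-dec ¬? (x ≟ q) →-dec ¬? (y ≟ p) →-dec ¬? (y ≟ q) →-dec (x ≟ y)} _

alternate : ℕ → Fin 3
alternate zero          = 1F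
alternate (suc zero)    = 2F
alternate (suc (suc a)) = alternate a

alternate-≢0 : ∀ a → alternate a ≢ 0F
alternate-≢0 (suc (suc a)) e = alternate-≢0 a e

alternate-suc : ∀ a → alternate a ≢ alternate (suc a)
alternate-suc (suc (suc a)) e = alternate-suc a e

alternate-odd : ∀ k → alternate (suc (k * 2)) ≡ 2F
alternate-odd zero    = refl
alternate-odd (suc k) = alternate-odd k

ProperOff : (Vertex m → Fin 3) → Vertex m → Vertex m → Set
ProperOff c u v = ∀ {s t} → s ⟶ t → (s ≡ u × t ≡ v) ⊎ c s ≢ c t

sideColour : Bool → Fin 3
sideColour false = 1F
sideColour true  = 2F

module _ {m : ℕ} where

  -- Gadgets other than `i` get a standard colouring, with the apex coloured 0 like the hub, which
  -- is proper whenever the rim vertex avoids 0. The rim and gadget `i` stay free for the edge to be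
  -- omitted.
  palette : Fin m → (Fin m → Fin 3) → Fin 3 → (Bool → Fin 3) → Vertex m → Fin 3
  palette i ρ α σ hub        = 0F
  palette i ρ α σ (rim j)    = ρ j
  palette i ρ α σ (apex j)   = if ⌊ j ≟ i ⌋ then α else 0F
  palette i ρ α σ (side s j) = if ⌊ j ≟ i ⌋ then σ s else sideColour s

  palette-properOff :
    ∀ {i ρ α σ u v} →
    (∀ {s t} → Next s t → (rim s ≡ u × rim t ≡ v) ⊎ ρ s ≢ ρ t) →
    (∀ {j} → j ≢ i → ρ j ≢ 0F) →
    (rim i ≡ u × apex i ≡ v) ⊎ ρ i ≢ α →
    (∀ s → (apex i ≡ u × side s i ≡ v) ⊎ α ≢ σ s) →
    (side false i ≡ u × side true i ≡ v) ⊎ σ false ≢ σ true →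
    (∀ s → (hub ≡ u × side s i ≡ v) ⊎ 0F ≢ σ s) →
    ProperOff (palette i ρ α σ) u v
  palette-properOff rr r≢0 ra as ss hs (rim-rim e) = rr e
  palette-properOff {i} rr r≢0 ra as ss hs (rim-apex {j}) with j ≟ i
  ... | yes refl = ra
  ... | no  j≢i  = inj₂ (r≢0 j≢i)
  palette-properOff {i} rr r≢0 ra as ss hs (apex-side {j} s) with j ≟ i
  ... | yes refl = as s
  palette-properOff {i} rr r≢0 ra as ss hs (apex-side {j} false) | no _ = inj₂ λ ()
  palette-properOff {i} rr r≢0 ra as ss hs (apex-side {j} true)  | no _ = inj₂ λ ()
  palette-properOff {i} rr r≢0 ra as ss hs (side-side {j}) with j ≟ i
  ... | yes refl = ss
  ... | no  _    = inj₂ λ ()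
  palette-properOff {i} rr r≢0 ra as ss hs (hub-side {j} s) with j ≟ i
  ... | yes refl = hs s
  palette-properOff {i} rr r≢0 ra as ss hs (hub-side {j} false) | no _ = inj₂ λ ()
  palette-properOff {i} rr r≢0 ra as ss hs (hub-side {j} true)  | no _ = inj₂ λ ()

-- Split wheels with odd rim are 4-critical.

module OddWheel (k : ℕ) where

  M : ℕ
  M = 3 + k * 2

  3≤M : 3 ≤ M
  3≤M = s≤s (s≤s (s≤s z≤n))

  W : Graph (Vertex M)
  W = splitWheel 3≤M

  -- Alternating around the odd rim, with the only conflict between i and its
  -- successor.
  broken : Fin M → Fin M → Fin 3
  broken i j = if ⌊ toℕ j ≤? toℕ i ⌋ then alternate (toℕ j) else alternate (suc (toℕ j))

  broken-≢0 : ∀ i j → broken i j ≢ 0F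
  broken-≢0 i j with toℕ j ≤? toℕ i
  ... | yes _ = alternate-≢0 (toℕ j)
  ... | no  _ = alternate-≢0 (suc (toℕ j))

  broken-next : ∀ {i s t} → s ≢ i → Next s t → broken i s ≢ broken i t
  broken-next {i} {s} {t} s≢i st with toℕ s ≤? toℕ i | toℕ t ≤? toℕ i
  broken-next {s = s} s≢i (inj₁ e) | yes _ | yes _ rewrite e = alternate-suc (toℕ s)
  -- The shift of the alternation falls between `s` and its successor only for `s = i`.
  broken-next s≢i (inj₁ e) | yes s≤i | no t≰i =
    contradiction (toℕ-injective (≤-antisym s≤i (≤-pred (subst (_ <_) e (≰⇒> t≰i))))) s≢i
  broken-next s≢i (inj₁ e) | no s≰i | yes t≤i =
    contradiction (≤-trans (≤-trans (n≤1+n _) (≤-reflexive (sym e))) t≤i) s≰i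
  broken-next {s = s} s≢i (inj₁ e) | no _ | no _ rewrite e = alternate-suc (suc (toℕ s))
  broken-next {i} s≢i (inj₂ (e , _)) | yes s≤i | _ =
    contradiction (toℕ-injective (≤-antisym s≤i (≤-pred (subst (toℕ i <_) (sym e) (toℕ<n i))))) s≢i
  -- The oddness of the rim enters here: the last vertex, lying after `i`, gets `alternate M`, which
  -- is 2, while position 0 gets 1.
  broken-next s≢i (inj₂ (e , t≡0)) | no _ | yes _ rewrite e | t≡0 | alternate-odd k = λ ()
  broken-next s≢i (inj₂ (_ , t≡0)) | no _ | no t≰i =
    contradiction (subst (_≤ _) (sym t≡0) z≤n) t≰i

  -- Colour 0 at `i` removes the only conflict of `broken i`, so the rim becomes properly coloured
  -- with 0 at `i` alone.
  patched : Fin M → Fin M → Fin 3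
  patched i j = if ⌊ j ≟ i ⌋ then 0F else broken i j

  patched-self : ∀ i → patched i i ≡ 0F
  patched-self i with i ≟ i
  ... | yes _  = refl
  ... | no i≢i = contradiction refl i≢i

  patched-≢0 : ∀ {i j} → j ≢ i → patched i j ≢ 0F
  patched-≢0 {i} {j} j≢i with j ≟ i
  ... | yes j≡i = contradiction j≡i j≢i
  ... | no  _   = broken-≢0 i j

  patched-next : ∀ {i s t} → Next s t → patched i s ≢ patched i t
  patched-next {i} {s} {t} st with s ≟ i | t ≟ i
  ... | yes refl | yes refl = contradiction st (next-asym 3≤M st)
  ... | yes refl | no  _    = broken-≢0 s t ∘ sym
  ... | no  _    | yes refl = broken-≢0 t s
  ... | no  s≢i  | no  _    = broken-next s≢i st

  patched-≢ : ∀ {i a} → 0F ≢ a → patched i i ≢ a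
  patched-≢ {i} 0≢a e = 0≢a (trans (sym (patched-self i)) e)

  sides : Fin 3 → Fin 3 → Bool → Fin 3
  sides a b false = a
  sides a b true  = b

  gadgetColouring : Fin M → Fin 3 → Fin 3 → Fin 3 → Vertex M → Fin 3
  gadgetColouring i α a b = palette i (patched i) α (sides a b)

  -- With hub and rim i both coloured 0, the six edges around gadget i are those
  -- of a K₄ on the colour classes 0, α, a, b.
  gadget-properOff :
    ∀ {i α a b u v} →
    (rim i ≡ u × apex i ≡ v) ⊎ 0F ≢ α →
    (apex i ≡ u × side false i ≡ v) ⊎ α ≢ a →
    (apex i ≡ u × side true i ≡ v) ⊎ α ≢ b →
    (side false i ≡ u × side true i ≡ v) ⊎ a ≢ b →
    (hub ≡ u × side false i ≡ v) ⊎ 0F ≢ a →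
    (hub ≡ u × side true i ≡ v) ⊎ 0F ≢ b →
    ProperOff (gadgetColouring i α a b) u v
  gadget-properOff {i} ra aa ab ss ha hb =
    palette-properOff (inj₂ ∘ patched-next) patched-≢0
      ([ inj₁ , inj₂ ∘ patched-≢ {i} ]′ ra)
      (λ { false → aa ; true → ab }) ss (λ { false → ha ; true → hb })

  -- For a rim edge, `broken` leaves just that conflict and all gadgets are standard. For an edge of
  -- gadget `i`, the K₄ on the colour classes loses an edge: its two ends share a colour and the
  -- other two classes take the remaining colours.
  arc-critical : ∀ {u v} → u ⟶ v → ∃ λ c → ProperOff c u v
  arc-critical (rim-rim {i} {j} ij) =
    palette i (broken i) 0F sideColour ,
    palette-properOff rr (λ {l} _ → broken-≢0 i l) (inj₂ (broken-≢0 i i))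
      (λ { false → inj₂ λ () ; true → inj₂ λ () }) (inj₂ λ ())
      (λ { false → inj₂ λ () ; true → inj₂ λ () })
    where
    rr : ∀ {s t} → Next s t → (rim s ≡ rim i × rim t ≡ rim j) ⊎ broken i s ≢ broken i t
    rr {s} st with s ≟ i
    ... | yes refl = inj₁ (refl , cong rim (next-functional st ij))
    ... | no  s≢i  = inj₂ (broken-next s≢i st)
  arc-critical (rim-apex {i}) = gadgetColouring i 0F 1F 2F ,
    gadget-properOff
      (inj₁ (refl , refl)) (inj₂ λ ()) (inj₂ λ ()) (inj₂ λ ()) (inj₂ λ ()) (inj₂ λ ())
  arc-critical (apex-side {i} false) = gadgetColouring i 1F 1F 2F ,
    gadget-properOff
      (inj₂ λ ()) (inj₁ (refl , refl)) (inj₂ λ ()) (inj₂ λ ()) (inj₂ λ ()) (inj₂ λ ())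
  arc-critical (apex-side {i} true) = gadgetColouring i 2F 1F 2F ,
    gadget-properOff
      (inj₂ λ ()) (inj₂ λ ()) (inj₁ (refl , refl)) (inj₂ λ ()) (inj₂ λ ()) (inj₂ λ ())
  arc-critical (side-side {i}) = gadgetColouring i 2F 1F 1F ,
    gadget-properOff
      (inj₂ λ ()) (inj₂ λ ()) (inj₂ λ ()) (inj₁ (refl , refl)) (inj₂ λ ()) (inj₂ λ ())
  arc-critical (hub-side {i} false) = gadgetColouring i 1F 0F 2F ,
    gadget-properOff
      (inj₂ λ ()) (inj₂ λ ()) (inj₂ λ ()) (inj₂ λ ()) (inj₁ (refl , refl)) (inj₂ λ ())
  arc-critical (hub-side {i} true) = gadgetColouring i 2F 1F 0F ,
    gadget-properOff
      (inj₂ λ ()) (inj₂ λ ()) (inj₂ λ ()) (inj₂ λ ()) (inj₂ λ ()) (inj₁ (refl , refl))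

  -- In three colours each diamond gives its apex the colour of the hub, so the pendant edge acts as
  -- a spoke. The odd rim would then have to be coloured with the two other colours.
  ¬3-colourable : ¬ Colorable W 3
  ¬3-colourable (c , proper) = c≢ (rim-rim wrap)
    (trans (evens (suc k) ≤-refl) (cong (c ∘ rim) (toℕ-injective refl)))
    where
    c≢ : ∀ {u v} → u ⟶ v → c u ≢ c v
    c≢ e = proper _ _ (—⇒adj 3≤M (inj₁ e))

    apex-hub : ∀ i → c (apex i) ≡ c hub
    apex-hub i = third-colour-unique (c (side false i)) (c (side true i)) _ _ (c≢ side-side)
      (c≢ (apex-side _)) (c≢ (apex-side _)) (c≢ (hub-side _)) (c≢ (hub-side _))

    rim-hub : ∀ i → c (rim i) ≢ c hub
    rim-hub i e = c≢ rim-apex (trans e (sym (apex-hub i)))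

    wrap : Next (fromℕ< {suc k * 2} {M} ≤-refl) zero
    wrap = inj₂ (cong suc (toℕ-fromℕ< {suc k * 2} {M} ≤-refl) , refl)

    -- Rim vertices two apart both avoid the colours of the hub and of the vertex between them. The
    -- last position `suc k * 2` is even, so `wrap` joins two equal colours.
    evens : ∀ a (a<M : a * 2 < M) → c (rim (fromℕ< a<M)) ≡ c (rim zero)
    evens zero    _   = refl
    evens (suc a) a<M = trans
      (third-colour-unique (c hub) (c (rim (fromℕ< a₁<M))) _ _
        (rim-hub _ ∘ sym) (rim-hub _) (c≢ (rim-rim (next-fromℕ< a₁<M a<M)) ∘ sym)
        (rim-hub _) (c≢ (rim-rim (next-fromℕ< a₀<M a₁<M))))
      (evens a a₀<M)
      where
      a₁<M = ≤-trans (n≤1+n _) a<M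
      a₀<M = ≤-trans (n≤1+n _) a₁<M

      next-fromℕ< : ∀ {b} (p : b < M) (q : suc b < M) → Next (fromℕ< p) (fromℕ< q)
      next-fromℕ< p q = inj₁ (trans (toℕ-fromℕ< q) (cong suc (sym (toℕ-fromℕ< p))))

  -- The hub and the apexes are pairwise non-adjacent and share the fourth colour. Sides and rim are
  -- then not adjacent to each other and use the first three independently.
  colourable : Colorable W 4
  colourable = c , λ u v e → [ c≢ , (λ a → c≢ a ∘ sym) ]′ (adj⇒— 3≤M {u} {v} e)
    where
    c : Vertex M → Fin 4
    c hub            = 3F
    c (rim i)        = inject≤ (patched zero i) (n≤1+n 3)
    c (apex _)       = 3F
    c (side false _) = 0F
    c (side true _)  = 1F

    inject≤-≢3F : ∀ (x : Fin 3) → inject≤ x (n≤1+n 3) ≢ 3F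
    inject≤-≢3F 0F ()
    inject≤-≢3F 1F ()
    inject≤-≢3F 2F ()

    c≢ : ∀ {u v} → u ⟶ v → c u ≢ c v
    c≢ (rim-rim e)       = patched-next {zero} e ∘ inject≤-injective _ _ _ _
    c≢ (rim-apex {i})    = inject≤-≢3F (patched zero i)
    c≢ (apex-side false) ()
    c≢ (apex-side true)  ()
    c≢ side-side         ()
    c≢ (hub-side false)  ()
    c≢ (hub-side true)   ()

  edgeCritical : EdgeCritical W 3
  edgeCritical u v e with adj⇒— 3≤M e
  ... | inj₁ uv with arc-critical uv
  ... | c , off = c , λ s t st → [ one , two ]′ (adj⇒— 3≤M st)
    where
    one : ∀ {s t} → s ⟶ t → (s ≡ u × t ≡ v) ⊎ (s ≡ v × t ≡ u) ⊎ c s ≢ c t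
    one st = [ inj₁ , inj₂ ∘ inj₂ ]′ (off st)
    two : ∀ {s t} → t ⟶ s → (s ≡ u × t ≡ v) ⊎ (s ≡ v × t ≡ u) ⊎ c s ≢ c t
    two ts = [ inj₂ ∘ inj₁ ∘ swap , (λ ne → inj₂ (inj₂ (ne ∘ sym))) ]′ (off ts)
  edgeCritical u v e | inj₂ vu with arc-critical vu
  ... | c , off = c , λ s t st → [ one , two ]′ (adj⇒— 3≤M st)
    where
    one : ∀ {s t} → s ⟶ t → (s ≡ u × t ≡ v) ⊎ (s ≡ v × t ≡ u) ⊎ c s ≢ c t
    one st = [ inj₂ ∘ inj₁ , inj₂ ∘ inj₂ ]′ (off st)
    two : ∀ {s t} → t ⟶ s → (s ≡ u × t ≡ v) ⊎ (s ≡ v × t ≡ u) ⊎ c s ≢ c t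
    two ts = [ inj₁ ∘ swap , (λ ne → inj₂ (inj₂ (ne ∘ sym))) ]′ (off ts)

  noIsolated : NoIsolated W
  noIsolated hub        = side true zero , —⇒adj 3≤M {hub} {side true zero} (inj₁ (hub-side true))
  noIsolated (rim i)    = apex i , —⇒adj 3≤M {rim i} (inj₁ rim-apex)
  noIsolated (apex i)   = side true i , —⇒adj 3≤M {apex i} (inj₁ (apex-side true))
  noIsolated (side s i) = hub , —⇒adj 3≤M {side s i} {hub} (inj₂ (hub-side s))

  -- Transport to the vertex set `Fin (suc (M * 4))`.

  G : Graph (Fin (suc (M * 4)))
  G = pullback decode W

  G-noIsolated : NoIsolated G
  G-noIsolated x with noIsolated (decode x)
  ... | v , e = encode v , subst (Adj W (decode x)) (sym (decode-encode v)) e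

  G-edgeCritical : EdgeCritical G 3
  G-edgeCritical x y e with edgeCritical (decode x) (decode y) e
  ... | f , off = f ∘ decode , λ s t st → pull (off (decode s) (decode t) st)
    where
    pull : ∀ {s t} →
      (decode s ≡ decode x × decode t ≡ decode y) ⊎
      (decode s ≡ decode y × decode t ≡ decode x) ⊎ f (decode s) ≢ f (decode t) →
      (s ≡ x × t ≡ y) ⊎ (s ≡ y × t ≡ x) ⊎ f (decode s) ≢ f (decode t)
    pull (inj₁ (p , q))        = inj₁ (decode-injective p , decode-injective q)
    pull (inj₂ (inj₁ (p , q))) = inj₂ (inj₁ (decode-injective p , decode-injective q))
    pull (inj₂ (inj₂ ne))      = inj₂ (inj₂ ne)

  G-¬3-colourable : ¬ Colorable G 3
  G-¬3-colourable (c , proper) = ¬3-colourable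
    (c ∘ encode , λ u v e → proper (encode u) (encode v)
      (subst₂ (Adj W) (sym (decode-encode u)) (sym (decode-encode v)) e))

  G-critical : Critical 4 G
  G-critical =
    chromaticNumber {G = G}
      (proj₁ colourable ∘ decode , λ u v → proj₂ colourable (decode u) (decode v))
      G-¬3-colourable ,
    edgeCritical⇒properColorable G-noIsolated G-edgeCritical

  G-numChords≤144 : (C : Cycle G) → numChords C ≤ 144
  -- `push` keeps positions, and adjacency in `G` is by definition adjacency of decoded vertices, so
  -- both cycles have the same list of chords definitionally.
  G-numChords≤144 C = CycleChords.numChords≤144 3≤M (push decode-injective C)

  ¬forces145 : ∀ {α} → 145 ≤ α → ¬ ForcesChords 4 (suc (M * 4)) α
  ¬forces145 145≤α forces with forces G G-critical
  ... | (C , _) , α≤ = 1+n≰n (≤-trans 145≤α (≤-trans α≤ (G-numChords≤144 C)))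

corollary3p9 : ¬ VossConjecture
-- The conjecture already fails for `k = 4`; 145 is one more than the bound on chords.
corollary3p9 voss with voss 4 ≤-refl 145
-- The wheel with parameter `N` is large enough, as `N ≤ N * 2 ≤ M ≤ M * 4`.
... | N , large with large (suc (OddWheel.M N * 4))
  (≤-trans (m≤m*n N 2) (≤-trans (m≤n+m (N * 2) 3) (≤-trans (m≤m*n (OddWheel.M N) 4) (n≤1+n _))))
... | [ α ]⁺ , (forces , _) , [ 145≤α ] = OddWheel.¬forces145 N 145≤α forces
-- An infinite value would force every number of chords, in particular 145.
... | ∞      , forces       , _         = OddWheel.¬forces145 N ≤-refl (forces 145)
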